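{- Let $n$ be an even positive integer and let $F\colon\mathbb{F}_{2^{n/2}}\times\mathbb{F}_{2^{n/2}}\to\mathbb{F}_{2^{n/2}}$ be an o-polynomial bent function defined by $$F(x,y)=x\,\Psi\!\left(yx^{2^{n/2}-2}\right),$$ where $\Psi\colon\mathbb{F}_{2^{n/2}}\to\mathbb{F}_{2^{n/2}}$ is an o-polynomial. Then $|F^{ -1}(0)|=2^{n/2+1}-1$ and $|F^{ -1}(\beta)|=2^{n/2}-1$ for each $\beta\neq0$; hence $F$ is almost balanced of type $(+)$.
   Context: A permutation polynomial $\Psi$ over $\mathbb{F}_{2^k}$ is called an o-polynomial if for every $a\in\mathbb{F}_{2^k}^*$ the function sending $z\neq0$ to $\frac{\Psi(z+a)+\Psi(a)}{z}$ and $0$ to $0$ is a permutation of $\mathbb{F}_{2^k}$. The expression $x^{2^{n/2}-2}$ stands for $x^{ -1}$ with $0^{ -1}=0$. A function $F\colon\mathbb{F}_2^n\to\mathbb{F}_2^m$ is bent (perfect nonlinear) if $|\{x: F(x+a)-F(x)=b\}|=2^{n-m}$ for all nonzero $a$ and all $b$; it is understood (hypothesis) that the $F$ in the claim is bent, with $\mathbb{F}_{2^{n/2}}\times\mathbb{F}_{2^{n/2}}$ identified with $\mathbb{F}_2^n$ and $\mathbb{F}_{2^{n/2}}$ with $\mathbb{F}_2^{n/2}$. A bent function $F\colon\mathbb{F}_2^n\to\mathbb{F}_2^m$ is almost balanced of type $(+)$ if there is $\alpha$ with $|F^{ -1}(\alpha)|=2^{n-m}+2^{n/2}-2^{n/2-m}$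 and $|F^{ -1}(\beta)|=2^{n-m}-2^{n/2-m}$ for all $\beta\ne\alpha$; here $m=n/2$. -}

module Defs where

open import Level using (Level; _⊔_) renaming (suc to lsuc)
open import Algebra.Structures using (IsCommutativeRing)
open import Data.Bool.Base using (Bool; false; _xor_)
open import Data.Fin.Base using (Fin)
open import Data.Fin.Properties using (inj⇒≟)
open import Data.List.Base using (List; foldr)
open import Data.Nat.Base using (ℕ; _∸_; _^_; _/_) renaming (_+_ to _+ℕ_)
open import Data.Product.Base using (∃; _×_; _,_)
open import Data.Vec.Base using (Vec; zipWith; replicate)
open import Function.Base using (_∘_)
open import Function.Bundles using (_↔_; Inverse)
open import Function.Definitions using (Bijective)
open import Function.Properties.Inverse using (↔⇒↣)
open import Relation.Binary.Definitions using (DecidableEquality)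
open import Relation.Binary.PropositionalEquality using (_≡_; _≢_; _≗_)
open import Relation.Nullary.Decidable using (yes; no)

private
  variable
    a b c : Level
    n m   : ℕ

-- "A has exactly N elements".  Below it is only applied to sets
-- { x ∣ f x ≡ y } with f landing in a type with decidable equality, where the
-- equation has at most one proof, so elements of the Σ-type are elements of
-- the set.
HasSize : Set a → ℕ → Set a
HasSize A N = A ↔ Fin N

Fibre : {A : Set a} {B : Set b} → (A → B) → B → Set (a ⊔ b)
Fibre f y = ∃ λ x → f x ≡ y

-- The field with q elements.  Inversion is total, with the convention
-- 0⁻¹ = 0.
record FiniteField c (q : ℕ) : Set (lsuc c) where
  infixl 6 _+_
  infixl 7 _*_
  infix  8 -_
  infix  9 _⁻¹
  field
    Carrier           : Set c
    _+_ _*_           : Carrier → Carrier → Carrier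
    -_ _⁻¹            : Carrier → Carrier
    0# 1#             : Carrier
    isCommutativeRing : IsCommutativeRing _≡_ _+_ _*_ -_ 0# 1#
    0≢1               : 0# ≢ 1#
    ⁻¹-inverseʳ       : ∀ x → x ≢ 0# → x * x ⁻¹ ≡ 1#
    0⁻¹≡0             : 0# ⁻¹ ≡ 0#
    size              : HasSize Carrier q

  open IsCommutativeRing isCommutativeRing public
    hiding (refl; sym; trans; reflexive)

  _≟_ : DecidableEquality Carrier
  _≟_ = inj⇒≟ (↔⇒↣ size)

  -- Coefficients are listed from the constant term upwards.
  eval : List Carrier → Carrier → Carrier
  eval p x = foldr (λ coeff r → coeff + x * r) 0# p

  infixl 6 _+²_
  _+²_ : Carrier × Carrier → Carrier × Carrier → Carrier × Carrier
  (x , y) +² (x′ , y′) = x + x′ , y + y′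

module _ {q : ℕ} (K : FiniteField c q) where
  open FiniteField K

  differenceQuotient : (Carrier → Carrier) → Carrier → Carrier → Carrier
  differenceQuotient Ψ a z with z ≟ 0#
  ... | yes _ = 0#
  ... | no  _ = (Ψ (z + a) + Ψ a) * z ⁻¹

  -- The definition is meant for q a power of 2, where + and - agree.
  record IsOPolynomial (Ψ : Carrier → Carrier) : Set c where
    field
      polynomial          : ∃ λ p → Ψ ≗ eval p
      permutation         : Bijective _≡_ _≡_ Ψ
      quotientPermutation : ∀ a → a ≢ 0# →
                            Bijective _≡_ _≡_ (differenceQuotient Ψ a)

  -- (x , y) ↦ x Ψ(y x^(q-2)), where x^(q-2) stands for x⁻¹ with 0⁻¹ = 0.
  oPolynomialMap : (Carrier → Carrier) → Carrier × Carrier → Carrier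
  oPolynomialMap Ψ (x , y) = x * Ψ (y * x ⁻¹)

-- 𝔽₂ is Bool with _xor_ as addition.
𝔽₂^_ : ℕ → Set
𝔽₂^ n = Vec Bool n

infixl 6 _⊕_
_⊕_ : 𝔽₂^ n → 𝔽₂^ n → 𝔽₂^ n
_⊕_ = zipWith _xor_

𝟎 : 𝔽₂^ n
𝟎 = replicate _ false

-- An isomorphism 𝔽₂^ n ≅ (A , _∙_).  Over 𝔽₂ additive maps are linear.
record Identification (n : ℕ) {A : Set a} (_∙_ : A → A → A) : Set a where
  field
    bijection : 𝔽₂^ n ↔ A
  open Inverse bijection public using (to; from)
  field
    additive  : ∀ u v → to (u ⊕ v) ≡ to u ∙ to v

transport : {A : Set a} {B : Set b} {_∙_ : A → A → A} {_⋆_ : B → B → B} →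
            Identification n _∙_ → Identification m _⋆_ →
            (A → B) → 𝔽₂^ n → 𝔽₂^ m
transport ι κ F = Identification.from κ ∘ F ∘ Identification.to ι

-- Subtraction in 𝔽₂^ m is _⊕_.  Truncating the exponent when m > n is harmless:
-- with 2^(n-m) read as a fraction or as 1, no F is bent if n ≥ 1, and every F
-- is (vacuously) if n = 0.
IsBent : (𝔽₂^ n → 𝔽₂^ m) → Set
IsBent {n} {m} F = ∀ a → a ≢ 𝟎 → ∀ b →
  HasSize (Fibre (λ x → F (x ⊕ a) ⊕ F x) b) (2 ^ (n ∸ m))

-- A bent F with n, m ≥ 1 exists only for n even and m ≤ n / 2, so neither the
-- division nor the subtractions lose anything; for n = 0 or m = 0 the rounded
-- terms cancel.
record IsAlmostBalanced⁺ (F : 𝔽₂^ n → 𝔽₂^ m) : Set where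
  field
    bent  : IsBent F
    α     : 𝔽₂^ m
    sizeα : HasSize (Fibre F α)
                    ((2 ^ (n ∸ m) +ℕ 2 ^ (n / 2)) ∸ 2 ^ (n / 2 ∸ m))
    sizeβ : ∀ β → β ≢ α →
            HasSize (Fibre F β) (2 ^ (n ∸ m) ∸ 2 ^ (n / 2 ∸ m))

{-# OPTIONS --safe #-}
-- For x ≠ 0 and any γ, bijectivity of Ψ makes x Ψ(y / x) = γ have the unique
-- solution y = x Ψ⁻¹(γ / x), so each fibre has q - 1 points off the line x = 0.
-- That line lies entirely in the fibre over 0 and adds q points to it.
module Submission where

open import Algebra.Structures using (IsCommutativeRing)
open import Axiom.UniquenessOfIdentityProofs.WithK using (uip)
open import Data.Fin.Base using (Fin; punchIn; punchOut)
open import Data.Fin.Properties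
  using (+↔⊎; punchInᵢ≢i; punchIn-punchOut; punchOut-punchIn; punchOut-cong)
open import Data.Nat.Base using (ℕ; suc; _+_; _∸_; _^_; _/_; _<_)
open import Data.Nat.Divisibility using (_∣_)
open import Data.Nat.DivMod using (m*[n/m]≡n)
open import Data.Nat.Properties
  using (+-identityʳ; +-comm; +-∸-assoc; m+n∸n≡m; n∸n≡0; m^n>0)
open import Data.Product.Base using (∃; _×_; _,_; proj₁; proj₂)
open import Data.Product.Function.Dependent.Propositional using (Σ-↔)
open import Data.Sum.Base using (_⊎_; inj₁; inj₂)
open import Data.Sum.Function.Propositional using (_⊎-↔_)
open import Function.Base using (_∘_)
open import Function.Bundles using (_↔_; Inverse; Injection; mk↔ₛ′)
open import Function.Definitions using (Bijective)
open import Function.Properties.Inverse using (↔-sym; ↔-trans; ↔⇒↣)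
open import Level using (Level)
open import Relation.Binary.PropositionalEquality
  using (_≡_; _≢_; refl; sym; trans; cong; cong₂; subst; subst₂; module ≡-Reasoning)
open import Relation.Nullary.Decidable using (yes; no)
open import Relation.Nullary.Negation using (contradiction)
open import Defs

private
  variable
    a b c d : Level
    q : ℕ

-- Lets points of a fibre, and nonzero field elements, be compared without regard to the proofs
-- attached to them.
Σ-≡-irrelevant : {A : Set a} {P : A → Set b} → (∀ {x} (p p′ : P x) → p ≡ p′) →
                 {s t : ∃ P} → proj₁ s ≡ proj₁ t → s ≡ t
Σ-≡-irrelevant irr refl = cong (_ ,_) (irr _ _)

-- Number the elements and delete the position of `y`: `punchOut` closes the gap and `punchIn`
-- reopens it.
∃≢-size : {A : Set a} → HasSize A q → ∀ y → HasSize (∃ λ (x : A) → x ≢ y) (q ∸ 1)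
∃≢-size {q = 0}     A↔Fin y with () ← Inverse.to A↔Fin y
∃≢-size {q = suc p} A↔Fin y = mk↔ₛ′ f g f∘g g∘f
  where
  open Inverse A↔Fin

  apart : ∀ {x} → x ≢ y → to y ≢ to x
  apart x≢y e = x≢y (sym (Injection.injective (↔⇒↣ A↔Fin) e))

  f : (∃ λ x → x ≢ y) → Fin p
  f (x , x≢y) = punchOut (apart x≢y)

  g : Fin p → ∃ λ x → x ≢ y
  g i = from (punchIn (to y) i) , λ e →
    punchInᵢ≢i (to y) i (trans (sym (strictlyInverseˡ _)) (cong to e))

  f∘g : ∀ i → f (g i) ≡ i
  f∘g i = trans (punchOut-cong (to y) (strictlyInverseˡ _)) (punchOut-punchIn (to y))

  g∘f : ∀ s → g (f s) ≡ s
  -- Any two proofs of a negation are definitionally equal.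
  g∘f (x , x≢y) = Σ-≡-irrelevant (λ _ _ → refl)
    (trans (cong from (punchIn-punchOut (apart x≢y))) (strictlyInverseʳ x))

-- Applying `to` or `from` turns one fibre equation into the other, and equality proofs are unique.
-- Sizes counted over the field thus carry over to bit vectors.
Fibre-transport : {A : Set a} {B : Set b} {C : Set c} {D : Set d}
                  (A↔B : A ↔ B) (C↔D : C ↔ D) (f : B → D) → ∀ y →
                  Fibre (Inverse.from C↔D ∘ f ∘ Inverse.to A↔B) y ↔ Fibre f (Inverse.to C↔D y)
Fibre-transport A↔B C↔D f y = Σ-↔ A↔B (mk↔ₛ′
  (λ e → trans (sym (strictlyInverseˡ _)) (cong to e))
  (λ e → trans (cong from e) (strictlyInverseʳ y))
  (λ _ → uip _ _) (λ _ → uip _ _))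
  where open Inverse C↔D

module _ (K : FiniteField c q) where
  open FiniteField K renaming (_+_ to _+ᴷ_; _*_ to _*ᴷ_)
  open IsCommutativeRing isCommutativeRing using () renaming (*-comm to *ᴷ-comm)
  open ≡-Reasoning

  x*[x⁻¹*y]≡y : ∀ {x} → x ≢ 0# → ∀ y → x *ᴷ (x ⁻¹ *ᴷ y) ≡ y
  x*[x⁻¹*y]≡y {x} x≢0 y = begin
    x *ᴷ (x ⁻¹ *ᴷ y) ≡⟨ *-assoc _ _ _ ⟨
    x *ᴷ x ⁻¹ *ᴷ y   ≡⟨ cong (_*ᴷ y) (⁻¹-inverseʳ x x≢0) ⟩
    1# *ᴷ y          ≡⟨ *-identityˡ y ⟩
    y                ∎

  [x*y]*x⁻¹≡y : ∀ {x} → x ≢ 0# → ∀ y → x *ᴷ y *ᴷ x ⁻¹ ≡ y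
  [x*y]*x⁻¹≡y {x} x≢0 y = begin
    x *ᴷ y *ᴷ x ⁻¹   ≡⟨ *-assoc _ _ _ ⟩
    x *ᴷ (y *ᴷ x ⁻¹) ≡⟨ cong (x *ᴷ_) (*ᴷ-comm _ _) ⟩
    x *ᴷ (x ⁻¹ *ᴷ y) ≡⟨ x*[x⁻¹*y]≡y x≢0 y ⟩
    y                ∎

  module _ (Ψ : Carrier → Carrier) (Ψ-bijective : Bijective _≡_ _≡_ Ψ) where

    private
      F : Carrier × Carrier → Carrier
      F = oPolynomialMap K Ψ

      Ψ⁻¹ : Carrier → Carrier
      Ψ⁻¹ = proj₁ ∘ proj₂ Ψ-bijective

      Ψ∘Ψ⁻¹ : ∀ z → Ψ (Ψ⁻¹ z) ≡ z
      Ψ∘Ψ⁻¹ z = proj₂ (proj₂ Ψ-bijective z) refl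

      solution : Carrier → Carrier → Carrier
      solution γ x = x *ᴷ Ψ⁻¹ (x ⁻¹ *ᴷ γ)

    F-zeroˡ : ∀ y → F (0# , y) ≡ 0#
    F-zeroˡ y = zeroˡ _

    F-solution : ∀ γ {x} → x ≢ 0# → F (x , solution γ x) ≡ γ
    F-solution γ {x} x≢0 = begin
      x *ᴷ Ψ (solution γ x *ᴷ x ⁻¹)  ≡⟨ cong (λ z → x *ᴷ Ψ z) ([x*y]*x⁻¹≡y x≢0 _) ⟩
      x *ᴷ Ψ (Ψ⁻¹ (x ⁻¹ *ᴷ γ))       ≡⟨ cong (x *ᴷ_) (Ψ∘Ψ⁻¹ _) ⟩
      x *ᴷ (x ⁻¹ *ᴷ γ)               ≡⟨ x*[x⁻¹*y]≡y x≢0 γ ⟩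
      γ                              ∎

    -- Both candidates for `y / x` are sent by `Ψ` to `γ / x`, so injectivity of `Ψ` identifies
    -- them.
    solution-unique : ∀ {γ x y} → x ≢ 0# → F (x , y) ≡ γ → solution γ x ≡ y
    solution-unique {γ} {x} {y} x≢0 Fxy≡γ = begin
      x *ᴷ Ψ⁻¹ (x ⁻¹ *ᴷ γ) ≡⟨ cong (x *ᴷ_) (proj₁ Ψ-bijective Ψ-eq) ⟩
      x *ᴷ (y *ᴷ x ⁻¹)     ≡⟨ *-assoc _ _ _ ⟨
      x *ᴷ y *ᴷ x ⁻¹       ≡⟨ [x*y]*x⁻¹≡y x≢0 y ⟩
      y                    ∎
      where
      Ψ-eq : Ψ (Ψ⁻¹ (x ⁻¹ *ᴷ γ)) ≡ Ψ (y *ᴷ x ⁻¹)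
      Ψ-eq = begin
        Ψ (Ψ⁻¹ (x ⁻¹ *ᴷ γ))             ≡⟨ Ψ∘Ψ⁻¹ _ ⟩
        x ⁻¹ *ᴷ γ                       ≡⟨ cong (x ⁻¹ *ᴷ_) Fxy≡γ ⟨
        x ⁻¹ *ᴷ (x *ᴷ Ψ (y *ᴷ x ⁻¹))    ≡⟨ *ᴷ-comm _ _ ⟩
        x *ᴷ Ψ (y *ᴷ x ⁻¹) *ᴷ x ⁻¹      ≡⟨ [x*y]*x⁻¹≡y x≢0 _ ⟩
        Ψ (y *ᴷ x ⁻¹)                   ∎

    -- A point with `x = 0` has value 0, so it cannot lie over `β`; elsewhere `x` determines `y`.
    -- Projection to `x` is therefore the bijection.
    nonzeroFibre : ∀ β → β ≢ 0# → Fibre F β ↔ ∃ λ x → x ≢ 0#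
    nonzeroFibre β β≢0 = mk↔ₛ′
      (λ { ((x , y) , e) → x , λ { refl → β≢0 (trans (sym e) (F-zeroˡ y)) } })
      (λ { (x , x≢0) → (x , solution β x) , F-solution β x≢0 })
      (λ _ → refl)
      (λ { ((x , y) , e) → Σ-≡-irrelevant uip (cong (x ,_) (solution-unique
             (λ { refl → β≢0 (trans (sym e) (F-zeroˡ y)) }) e)) })

    -- The left summand records `y` on the line `x = 0`, the right one records `x` off that line.
    zeroFibre : Fibre F 0# ↔ (Carrier ⊎ ∃ λ x → x ≢ 0#)
    zeroFibre = mk↔ₛ′ f g f∘g g∘f
      where
      f : Fibre F 0# → Carrier ⊎ ∃ λ x → x ≢ 0#
      f ((x , y) , _) with x ≟ 0#
      ... | yes _   = inj₁ y
      ... | no  x≢0 = inj₂ (x , x≢0)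

      g : (Carrier ⊎ ∃ λ x → x ≢ 0#) → Fibre F 0#
      g (inj₁ y)         = (0# , y) , F-zeroˡ y
      g (inj₂ (x , x≢0)) = (x , solution 0# x) , F-solution 0# x≢0

      f∘g : ∀ s → f (g s) ≡ s
      -- The test inside `f` does not reduce over an abstract field, so its impossible outcome has
      -- to be refuted.
      f∘g (inj₁ y) with 0# ≟ 0#
      ... | yes _   = refl
      ... | no  0≢0 = contradiction refl 0≢0
      f∘g (inj₂ (x , x≢0)) with x ≟ 0#
      ... | yes x≡0 = contradiction x≡0 x≢0
      ... | no  _   = refl

      g∘f : ∀ s → g (f s) ≡ s
      g∘f ((x , y) , e) with x ≟ 0#
      ... | yes x≡0 = Σ-≡-irrelevant uip (cong (_, y) (sym x≡0))
      ... | no  x≢0 = Σ-≡-irrelevant uip (cong (x ,_) (solution-unique x≢0 e))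

    nonzeroFibre-size : ∀ β → β ≢ 0# → HasSize (Fibre F β) (q ∸ 1)
    nonzeroFibre-size β β≢0 = ↔-trans (nonzeroFibre β β≢0) (∃≢-size size 0#)

    zeroFibre-size : HasSize (Fibre F 0#) (q + (q ∸ 1))
    zeroFibre-size =
      ↔-trans zeroFibre (↔-trans (size ⊎-↔ ∃≢-size size 0#) (↔-sym +↔⊎))

-- Since `2 ^ m` is at least 1, the truncated subtraction can be moved outside the sum, leaving a
-- doubling.
2^m+[2^m∸1]≡2^[m+1]∸1 : ∀ m → 2 ^ m + (2 ^ m ∸ 1) ≡ 2 ^ (m + 1) ∸ 1
2^m+[2^m∸1]≡2^[m+1]∸1 m = begin
  2 ^ m + (2 ^ m ∸ 1)       ≡⟨ +-∸-assoc (2 ^ m) (m^n>0 2 m) ⟨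
  2 ^ m + 2 ^ m ∸ 1         ≡⟨ cong (λ k → 2 ^ m + k ∸ 1) (+-identityʳ _) ⟨
  2 ^ (1 + m) ∸ 1           ≡⟨ cong (λ k → 2 ^ k ∸ 1) (+-comm 1 m) ⟩
  2 ^ (m + 1) ∸ 1           ∎
  where open ≡-Reasoning

-- Evenness makes the division exact, so `n` is twice `n / 2`.
n∸n/2≡n/2 : ∀ {n} → 2 ∣ n → n ∸ n / 2 ≡ n / 2
n∸n/2≡n/2 {n} 2∣n = begin
  n ∸ n / 2                     ≡⟨ cong (_∸ n / 2) (m*[n/m]≡n 2∣n) ⟨
  n / 2 + (n / 2 + 0) ∸ n / 2   ≡⟨ cong (λ k → n / 2 + k ∸ n / 2) (+-identityʳ _) ⟩
  n / 2 + n / 2 ∸ n / 2         ≡⟨ m+n∸n≡m (n / 2) (n / 2) ⟩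
  n / 2                         ∎
  where open ≡-Reasoning

proposition3p4 : ∀ {c} (n : ℕ) → 0 < n → 2 ∣ n →
    (K : FiniteField c (2 ^ (n / 2))) →
    let module K = FiniteField K in
    (ι : Identification n K._+²_) (κ : Identification (n / 2) K._+_)
    (Ψ : K.Carrier → K.Carrier) → IsOPolynomial K Ψ →
    let F = oPolynomialMap K Ψ in
    IsBent (transport ι κ F) →
    HasSize (Fibre F K.0#) (2 ^ (n / 2 + 1) ∸ 1)
    × (∀ β → β ≢ K.0# → HasSize (Fibre F β) (2 ^ (n / 2) ∸ 1))
    × IsAlmostBalanced⁺ (transport ι κ F)
proposition3p4 n _ 2∣n K ι κ Ψ Ψ-oPolynomial F-bent =
  subst (HasSize _) (2^m+[2^m∸1]≡2^[m+1]∸1 (n / 2)) size₀ , sizeᵝ , record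
  { bent  = F-bent
  -- The exceptional value is the vector identified with 0, whose fibre contains the whole line
  -- `x = 0`.
  ; α     = κ.from K.0#
  ; sizeα = ↔-trans (Fibre-transport ι.bijection κ.bijection F _)
      (subst₂ (λ γ N → HasSize (Fibre F γ) N) (sym (κ.strictlyInverseˡ _)) α-count size₀)
  ; sizeβ = λ β β≢α → ↔-trans (Fibre-transport ι.bijection κ.bijection F β)
      (subst (HasSize _) β-count (sizeᵝ (κ.to β) λ e →
        β≢α (trans (sym (κ.strictlyInverseʳ β)) (cong κ.from e))))
  }
  where
  module K = FiniteField K
  module ι = Identification ι
  module κ where
    open Identification κ public
    open Inverse bijection public using (strictlyInverseˡ; strictlyInverseʳ)

  m = n / 2
  F = oPolynomialMap K Ψ
  Ψ-bijective = IsOPolynomial.permutation Ψ-oPolynomial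

  size₀ : HasSize (Fibre F K.0#) (2 ^ m + (2 ^ m ∸ 1))
  size₀ = zeroFibre-size K Ψ Ψ-bijective

  sizeᵝ : ∀ β → β ≢ K.0# → HasSize (Fibre F β) (2 ^ m ∸ 1)
  sizeᵝ = nonzeroFibre-size K Ψ Ψ-bijective

  -- With `n = 2m`, the terms of type (+) simplify: `2 ^ (n ∸ m)` is `2 ^ m` and `2 ^ (m ∸ m)` is 1.
  β-count : 2 ^ m ∸ 1 ≡ 2 ^ (n ∸ m) ∸ 2 ^ (m ∸ m)
  β-count = sym (cong₂ (λ i j → 2 ^ i ∸ 2 ^ j) (n∸n/2≡n/2 2∣n) (n∸n≡0 m))

  α-count : 2 ^ m + (2 ^ m ∸ 1) ≡ 2 ^ (n ∸ m) + 2 ^ m ∸ 2 ^ (m ∸ m)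
  α-count = trans (sym (+-∸-assoc (2 ^ m) (m^n>0 2 m)))
    (sym (cong₂ (λ i j → 2 ^ i + 2 ^ m ∸ 2 ^ j) (n∸n/2≡n/2 2∣n) (n∸n≡0 m)))
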